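{- Each of the two greedy heuristics greedy-longest and greedy-shortest has worst-case approximation ratio $\Omega(m/\log m)$ for $\mathrm{MFD}_{\mathbb N}$ on sparse graphs. That is, for each of the two heuristics there exist constants $c, C>0$ and an infinite family of instances $(G,X)$, where $G=(V,E)$ is an $s$-$t$ DAG with $m=|E|\le C\,|V|$ and $m$ unbounded over the family, and $X\colon E\to\mathbb N$ is a flow, such that on each instance of the family the number of paths used by the heuristic to decompose $X$ is at least $c\cdot\frac{m}{\log m}\cdot \mathrm{mfd}_{\mathbb N}(G,X)$.
   Context: An $s$-$t$ DAG is a directed acyclic graph $G=(V,E)$ with a unique source $s$ (no in-edges) and a unique sink $t$ (no out-edges). A flow is a function $X$ on $E$ such that at every node of $V\setminus\{s,t\}$ incoming flow equals outgoing flow. An $s$-$t$ path $P$ is identified with the flow that is $1$ on the edges of $P$ and $0$ elsewhere. A flow decomposition of $(G,X)$ of size $k$ with weights in $\mathbb N$ ($0\in\mathbb N$) is a family of $s$-$t$ paths $P_1,\dots,P_k$ with weights $w_1,\dots,w_k\in\mathbb N$ such that $X=w_1P_1+\dots+w_kP_k$; $\mathrm{mfd}_{\mathbb N}(G,X)$ is the smallest size of such a decomposition, and $\mathrm{MFD}_{\mathbb N}$ is the problem of finding one of smallest size. Greedy-longest (respectively greedy-shortest) is the algorithm that, starting from $X$, repeatedly picks an $s$-$t$ path with the largest (respectively smallest) number of edges among the $s$-$t$ paths all of whose edges have positive remaining flow (ties broken arbitrarily), adds it to the decomposition with the maximum possible weight, i.e. the minimum remaining flow over its edges, and subtracts this weight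 from the remaining flow on each of its edges, until the remaining flow is $0$. -}

module Defs where

open import Data.Nat.Base using (ℕ; suc; _*_; _∸_; _≤_; _<_)
open import Data.Nat.Properties using (+-0-commutativeMonoid)
open import Data.Integer.Base using (+_)
open import Data.Rational.Unnormalised.Base using (ℚᵘ; _/_)
open import Data.Fin.Base using (Fin)
open import Data.Fin.Properties using (_≟_)
open import Data.List.Base using (List; []; _∷_; length)
open import Data.List.Membership.Propositional using (_∈_)
import Data.List.Membership.DecPropositional as DecMembership
open import Data.Bool.Base using (if_then_else_)
open import Data.Product.Base using (∃-syntax; _×_)
open import Relation.Nullary.Decidable.Core using (does)
open import Relation.Binary.PropositionalEquality.Core using (_≡_; _≢_)
open import Algebra.Properties.CommutativeMonoid.Sum +-0-commutativeMonoid using (sum)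

fromℕ : ℕ → ℚᵘ
fromℕ n = + n / 1

-- Walk tail head u es v: the edges es, in order, lead from u to v.
data Walk {n m : ℕ} (tail head : Fin m → Fin n) : Fin n → List (Fin m) → Fin n → Set where
  []  : ∀ {v} → Walk tail head v [] v
  _∷_ : ∀ {u v e es} → tail e ≡ u → Walk tail head (head e) es v →
        Walk tail head u (e ∷ es) v

-- The edge e goes from tail e to head e. By `simple`, E is a subset of V × V
-- (no parallel edges).
record STDAG : Set where
  field
    ∣V∣ ∣E∣      : ℕ
    tail head    : Fin ∣E∣ → Fin ∣V∣
    simple       : ∀ {e f} → tail e ≡ tail f → head e ≡ head f → e ≡ f
    acyclic      : ∀ {v es} → Walk tail head v es v → es ≡ []
    s t          : Fin ∣V∣
    s-source     : ∀ e → head e ≢ s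
    s-unique     : ∀ v → (∀ e → head e ≢ v) → v ≡ s
    t-sink       : ∀ e → tail e ≢ t
    t-unique     : ∀ v → (∀ e → tail e ≢ v) → v ≡ t

  V E : Set
  V = Fin ∣V∣
  E = Fin ∣E∣

module _ (G : STDAG) where
  open STDAG G
  open DecMembership (_≟_ {∣E∣}) using (_∈?_)

  inflow outflow : (E → ℕ) → V → ℕ
  inflow  X v = sum λ e → if does (head e ≟ v) then X e else 0
  outflow X v = sum λ e → if does (tail e ≟ v) then X e else 0

  IsFlow : (E → ℕ) → Set
  IsFlow X = ∀ v → v ≢ s → v ≢ t → inflow X v ≡ outflow X v

  -- In an acyclic graph a walk repeats no vertex, so s-t walks are s-t paths.
  record STPath : Set where
    constructor mkPath
    field
      edges : List E
      walk  : Walk tail head s edges t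
  open STPath

  pathFlow : STPath → E → ℕ
  pathFlow P e = if does (e ∈? edges P) then 1 else 0

  record Decomposition (X : E → ℕ) (k : ℕ) : Set where
    field
      path    : Fin k → STPath
      weight  : Fin k → ℕ
      correct : ∀ e → X e ≡ sum λ i → weight i * pathFlow (path i) e

  IsMFD : (E → ℕ) → ℕ → Set
  IsMFD X k = Decomposition X k × (∀ k′ → Decomposition X k′ → k ≤ k′)

data Heuristic : Set where
  greedy-longest greedy-shortest : Heuristic

-- AtLeastAsGood h ℓ ℓ′: a path with ℓ edges may be picked when one with ℓ′
-- edges is available.
AtLeastAsGood : Heuristic → ℕ → ℕ → Set
AtLeastAsGood greedy-longest  ℓ ℓ′ = ℓ′ ≤ ℓ
AtLeastAsGood greedy-shortest ℓ ℓ′ = ℓ ≤ ℓ′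

module _ (G : STDAG) where
  open STDAG G
  open STPath

  Available : (E → ℕ) → STPath G → Set
  Available X P = ∀ {e} → e ∈ edges P → 0 < X e

  GreedyChoice : Heuristic → (E → ℕ) → STPath G → Set
  GreedyChoice h X P =
    Available X P ×
    (∀ Q → Available X Q → AtLeastAsGood h (length (edges P)) (length (edges Q)))

  -- w is the minimum of X over the edges of P.
  IsBottleneck : (E → ℕ) → STPath G → ℕ → Set
  IsBottleneck X P w =
    (∃[ e ] e ∈ edges P × X e ≡ w) × (∀ {e} → e ∈ edges P → w ≤ X e)

  -- GreedyRun h X g: some execution of h from remaining flow X, with some way
  -- of breaking ties, uses exactly g paths. In `step`, ∸ never truncates, as
  -- w is at most X e on the edges of P.
  data GreedyRun (h : Heuristic) (X : E → ℕ) : ℕ → Set where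
    done : (∀ e → X e ≡ 0) → GreedyRun h X 0
    step : ∀ {g} (P : STPath G) (w : ℕ) →
           GreedyChoice h X P → IsBottleneck X P w →
           GreedyRun h (λ e → X e ∸ w * pathFlow G P e) g →
           GreedyRun h X (suc g)

-- The flow must not vanish: otherwise its mfd is 0 and there is no
-- approximation ratio to speak of.
record Instance : Set where
  field
    G        : STDAG
    X        : STDAG.E G → ℕ
    isFlow   : IsFlow G X
    nonZero  : ∃[ e ] X e ≢ 0

  open STDAG G public using (∣V∣; ∣E∣)

{-# OPTIONS --safe #-}

-- Chain F = 2ᵇ − 1 triangles: stage j leads from one vertex to the next either
-- by a direct edge or by a detour of two edges. Call the option that the
-- heuristic prefers (detour for longest, direct edge for shortest) preferred.
-- Send F units through the chain, with the values 1, …, F on the preferred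
-- options of the F stages and the rest on the others. Writing these values in
-- binary decomposes the flow into b paths of weights 1, 2, …, 2ᵇ⁻¹. Greedy takes
-- the preferred option wherever it still carries flow, so its path has weight 1
-- because of the stage with value 1, and then the values 2, …, F become
-- 1, …, F − 1. Hence greedy uses at least F paths, where ∣E∣ = 3F.
module Submission where

open import Defs
open import Data.Nat.Base using (ℕ; _≤_)
open import Data.Rational.Unnormalised.Base using (ℚᵘ; 0ℚᵘ) renaming (_<_ to _<ᵘ_; _≤_ to _≤ᵘ_; _*_ to _*ᵘ_)
open import Data.Product.Base using (Σ-syntax; ∃-syntax; _×_)
open import Data.Nat.Logarithm using (⌊log₂_⌋)
open Instance

open import Data.Nat.Base using (zero; suc; _+_; _*_; _∸_; _^_; _<_; pred; z≤n; s≤s)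
import Data.Nat.Properties as ℕ
open import Algebra.Properties.CommutativeMonoid.Sum ℕ.+-0-commutativeMonoid
  using (sum; sum-cong-≗; sum-replicate-zero)
open import Data.Nat.Logarithm using (⌊log₂⌋-mono-≤; ⌊log₂[2^n]⌋≡n)
import Data.Integer.Base as ℤ
import Data.Integer.Properties as ℤ
open import Data.Rational.Unnormalised.Base using (_/_; *≤*; *<*)
open import Data.Bool.Base using (Bool; true; false; not; if_then_else_)
import Data.Bool.Properties as Bool
open import Data.Fin.Base using (Fin; zero; suc; toℕ; _↑ʳ_)
import Data.Fin.Properties as Fin
open import Data.List.Base as List using (List; []; _∷_; length)
open import Data.List.Properties using (length-map)
open import Data.List.Membership.Propositional using (_∈_)
open import Data.List.Membership.Propositional.Properties using (∈-map⁺; ∈-map⁻)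
import Data.List.Membership.DecPropositional as DecMembership
open import Data.List.Relation.Unary.Any using (here; there)
open import Data.Vec.Base as Vec using (Vec; []; _∷_; lookup; tabulate; _[_]≔_)
open import Data.Vec.Properties
  using (lookup-map; lookup∘tabulate; lookup∘update; lookup∘update′; []≔-lookup)
open import Data.Product.Base using (_,_; proj₁; proj₂)
open import Data.Sum.Base using (_⊎_; inj₁; inj₂)
open import Function.Base using (_∘_)
open import Relation.Nullary.Decidable.Core using (does; yes; no)
open import Relation.Nullary.Decidable using (dec-true; dec-false)
open import Relation.Nullary.Negation using (¬_; contradiction)
open import Relation.Binary.PropositionalEquality

-- The chain of triangles

-- Stage j has the vertices 2j, 2j+1, 2j+2 and the edges 3j : 2j → 2j+2
-- (direct) and 3j+1 : 2j → 2j+1, 3j+2 : 2j+1 → 2j+2 (detour).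
tailᶜ headᶜ : ∀ {F} → Fin (F * 3) → Fin (suc (F * 2))
tailᶜ {suc F} zero                = zero
tailᶜ {suc F} (suc zero)          = zero
tailᶜ {suc F} (suc (suc zero))    = suc zero
tailᶜ {suc F} (suc (suc (suc e))) = suc (suc (tailᶜ {F} e))
headᶜ {suc F} zero                = suc (suc zero)
headᶜ {suc F} (suc zero)          = suc zero
headᶜ {suc F} (suc (suc zero))    = suc (suc zero)
headᶜ {suc F} (suc (suc (suc e))) = suc (suc (headᶜ {F} e))

lastVertex : ∀ F → Fin (suc (F * 2))
lastVertex zero    = zero
lastVertex (suc F) = suc (suc (lastVertex F))

-- The numbering of the vertices is a topological order, which excludes closed walks.
tail<head : ∀ {F} (e : Fin (F * 3)) → toℕ (tailᶜ {F} e) < toℕ (headᶜ {F} e)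
tail<head {suc F} zero                = s≤s z≤n
tail<head {suc F} (suc zero)          = s≤s z≤n
tail<head {suc F} (suc (suc zero))    = s≤s (s≤s z≤n)
tail<head {suc F} (suc (suc (suc e))) = s≤s (s≤s (tail<head {F} e))

Walkᶜ : ∀ F → Fin (suc (F * 2)) → List (Fin (F * 3)) → Fin (suc (F * 2)) → Set
Walkᶜ F = Walk (tailᶜ {F}) (headᶜ {F})

walk-≤ : ∀ {F u es v} → Walkᶜ F u es v → toℕ u ≤ toℕ v
walk-≤     []                      = ℕ.≤-refl
walk-≤ {F} (_∷_ {e = e} refl walk) = ℕ.≤-trans (ℕ.<⇒≤ (tail<head {F} e)) (walk-≤ {F} walk)

acyclicᶜ : ∀ {F v es} → Walkᶜ F v es v → es ≡ []
acyclicᶜ     []                      = refl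
acyclicᶜ {F} (_∷_ {e = e} refl walk) =
  contradiction (walk-≤ {F} walk) (ℕ.<⇒≱ (tail<head {F} e))

suc²-injective : ∀ {n} {i j : Fin n} → Fin.suc (suc i) ≡ suc (suc j) → i ≡ j
suc²-injective refl = refl

simpleᶜ : ∀ {F} (e f : Fin (F * 3)) →
          tailᶜ {F} e ≡ tailᶜ {F} f → headᶜ {F} e ≡ headᶜ {F} f → e ≡ f
simpleᶜ {suc F} zero                zero                _ _ = refl
simpleᶜ {suc F} zero                (suc zero)          _ ()
simpleᶜ {suc F} zero                (suc (suc zero))    ()
simpleᶜ {suc F} zero                (suc (suc (suc f))) ()
simpleᶜ {suc F} (suc zero)          zero                _ ()
simpleᶜ {suc F} (suc zero)          (suc zero)          _ _ = refl
simpleᶜ {suc F} (suc zero)          (suc (suc zero))    ()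
simpleᶜ {suc F} (suc zero)          (suc (suc (suc f))) ()
simpleᶜ {suc F} (suc (suc zero))    (suc (suc zero))    _ _ = refl
simpleᶜ {suc F} (suc (suc (suc e))) (suc (suc (suc f))) p q =
  cong (3 ↑ʳ_) (simpleᶜ {F} e f (suc²-injective p) (suc²-injective q))

s-sourceᶜ : ∀ {F} (e : Fin (F * 3)) → headᶜ {F} e ≢ zero
s-sourceᶜ {suc F} zero                ()
s-sourceᶜ {suc F} (suc zero)          ()
s-sourceᶜ {suc F} (suc (suc zero))    ()
s-sourceᶜ {suc F} (suc (suc (suc e))) ()

s-uniqueᶜ : ∀ F v → (∀ e → headᶜ {F} e ≢ v) → v ≡ zero
s-uniqueᶜ F       zero          _       = refl
s-uniqueᶜ (suc F) (suc zero)    no-edge = contradiction refl (no-edge (suc zero))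
s-uniqueᶜ (suc F) (suc (suc v)) no-edge
  -- By induction `v` could only be the first vertex of the remaining chain, but the direct edge of
  -- the first stage enters that vertex.
  with refl ← s-uniqueᶜ F v (λ e p → no-edge (3 ↑ʳ e) (cong (2 ↑ʳ_) p))
  = contradiction refl (no-edge zero)

t-sinkᶜ : ∀ {F} (e : Fin (F * 3)) → tailᶜ {F} e ≢ lastVertex F
t-sinkᶜ {suc F} (suc (suc (suc e))) p = t-sinkᶜ {F} e (suc²-injective p)

t-uniqueᶜ : ∀ F v → (∀ e → tailᶜ {F} e ≢ v) → v ≡ lastVertex F
t-uniqueᶜ zero    zero          _       = refl
t-uniqueᶜ (suc F) zero          no-edge = contradiction refl (no-edge zero)
t-uniqueᶜ (suc F) (suc zero)    no-edge = contradiction refl (no-edge (suc (suc zero)))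
t-uniqueᶜ (suc F) (suc (suc v)) no-edge =
  cong (2 ↑ʳ_) (t-uniqueᶜ F v (λ e p → no-edge (3 ↑ʳ e) (cong (2 ↑ʳ_) p)))

chain : ℕ → STDAG
chain F = record
  { ∣V∣ = suc (F * 2) ; ∣E∣ = F * 3
  ; tail = tailᶜ {F} ; head = headᶜ {F}
  ; simple = simpleᶜ {F} _ _ ; acyclic = acyclicᶜ {F}
  ; s = zero ; t = lastVertex F
  ; s-source = s-sourceᶜ {F} ; s-unique = s-uniqueᶜ F
  ; t-sink = t-sinkᶜ {F} ; t-unique = t-uniqueᶜ F
  }

-- Flows and paths below see an edge only through its stage and its option: the two halves of a
-- detour carry the same flow and lie on the same paths.
stage : ∀ {F} → Fin (F * 3) → Fin F
stage {suc F} zero                = zero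
stage {suc F} (suc zero)          = zero
stage {suc F} (suc (suc zero))    = zero
stage {suc F} (suc (suc (suc e))) = suc (stage e)

detour? : ∀ {F} → Fin (F * 3) → Bool
detour? {suc F} zero                = false
detour? {suc F} (suc zero)          = true
detour? {suc F} (suc (suc zero))    = true
detour? {suc F} (suc (suc (suc e))) = detour? {F} e

edgeOf : ∀ {F} (j : Fin F) κ → ∃[ e ] stage e ≡ j × detour? {F} e ≡ κ
edgeOf {suc F} zero    false = zero , refl , refl
edgeOf {suc F} zero    true  = suc zero , refl , refl
edgeOf {suc F} (suc j) κ     with edgeOf j κ
... | e , refl , refl = 3 ↑ʳ e , refl , refl

-- Paths of the chain

shift : ∀ {F} → List (Fin (F * 3)) → List (Fin (suc F * 3))
shift = List.map (3 ↑ʳ_)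

-- One Boolean per stage, `true` for the detour, encodes a path; by `walk-route` every s-t path
-- arises in this way.
route : ∀ {F} → Vec Bool F → List (Fin (F * 3))
route         []          = []
route {suc F} (false ∷ d) = zero ∷ shift {F} (route d)
route {suc F} (true  ∷ d) = suc zero ∷ suc (suc zero) ∷ shift {F} (route d)

shift-walk : ∀ {F u es v} → Walkᶜ F u es v →
             Walkᶜ (suc F) (2 ↑ʳ u) (shift {F} es) (2 ↑ʳ v)
shift-walk     []           = []
shift-walk {F} (refl ∷ walk) = refl ∷ shift-walk {F} walk

-- Edges of the first stage leave only the vertices 0 and 1, so a walk that starts beyond these
-- never uses them.
unshift-walk : ∀ {F u es v} → Walkᶜ (suc F) (suc (suc u)) es (suc (suc v)) →
               ∃[ es′ ] es ≡ shift {F} es′ × Walkᶜ F u es′ v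
unshift-walk     []                                       = [] , refl , []
unshift-walk {F} (_∷_ {e = suc (suc (suc e))} refl walk)
  with es′ , refl , walk′ ← unshift-walk {F} walk
  = e ∷ es′ , refl , refl ∷ walk′

route-walk : ∀ {F} (d : Vec Bool F) → Walkᶜ F zero (route d) (lastVertex F)
route-walk         []          = []
route-walk {suc F} (false ∷ d) = refl ∷ shift-walk {F} (route-walk d)
route-walk {suc F} (true  ∷ d) = refl ∷ refl ∷ shift-walk {F} (route-walk d)

walk-route : ∀ F {es} → Walkᶜ F zero es (lastVertex F) → ∃[ d ] es ≡ route {F} d
walk-route zero    []                                     = [] , refl
walk-route (suc F) (_∷_ {e = zero} _ walk)
  with es′ , refl , walk′ ← unshift-walk {F} walk
  with d , refl ← walk-route F walk′ = false ∷ d , refl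
walk-route (suc F) (_∷_ {e = suc (suc zero)} () _)
walk-route (suc F) (_∷_ {e = suc (suc (suc _))} () _)
walk-route (suc F) (_∷_ {e = suc zero} _ (_∷_ {e = zero} () _))
walk-route (suc F) (_∷_ {e = suc zero} _ (_∷_ {e = suc zero} () _))
walk-route (suc F) (_∷_ {e = suc zero} _ (_∷_ {e = suc (suc (suc _))} () _))
walk-route (suc F) (_∷_ {e = suc zero} _ (_∷_ {e = suc (suc zero)} _ walk))
  with es′ , refl , walk′ ← unshift-walk {F} walk
  with d , refl ← walk-route F walk′ = true ∷ d , refl

routePath : ∀ {F} → Vec Bool F → STPath (chain F)
routePath d = mkPath (route d) (route-walk d)

∈-shift⁻ : ∀ {F e es} → 3 ↑ʳ e ∈ shift {F} es → e ∈ es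
∈-shift⁻ e∈ with ∈-map⁻ (3 ↑ʳ_) e∈
... | _ , e′∈ , p with refl ← Fin.↑ʳ-injective 3 _ _ p = e′∈

∈-route⁺ : ∀ {F} (d : Vec Bool F) e → detour? {F} e ≡ lookup d (stage e) → e ∈ route d
∈-route⁺ {suc F} (false ∷ d) zero                _ = here refl
∈-route⁺ {suc F} (true  ∷ d) (suc zero)          _ = here refl
∈-route⁺ {suc F} (true  ∷ d) (suc (suc zero))    _ = there (here refl)
∈-route⁺ {suc F} (false ∷ d) (suc (suc (suc e))) p =
  there (∈-map⁺ (3 ↑ʳ_) (∈-route⁺ d e p))
∈-route⁺ {suc F} (true  ∷ d) (suc (suc (suc e))) p =
  there (there (∈-map⁺ (3 ↑ʳ_) (∈-route⁺ d e p)))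

∈-route⁻ : ∀ {F} (d : Vec Bool F) e → e ∈ route d → detour? {F} e ≡ lookup d (stage e)
∈-route⁻ {suc F} (false ∷ d) zero                _ = refl
∈-route⁻ {suc F} (true  ∷ d) zero                (there (there e∈))
  with _ , _ , () ← ∈-map⁻ (3 ↑ʳ_) e∈
∈-route⁻ {suc F} (true  ∷ d) (suc zero)          _ = refl
∈-route⁻ {suc F} (false ∷ d) (suc zero)          (there e∈)
  with _ , _ , () ← ∈-map⁻ (3 ↑ʳ_) e∈
∈-route⁻ {suc F} (true  ∷ d) (suc (suc zero))    _ = refl
∈-route⁻ {suc F} (false ∷ d) (suc (suc zero))    (there e∈)
  with _ , _ , () ← ∈-map⁻ (3 ↑ʳ_) e∈
∈-route⁻ {suc F} (false ∷ d) (suc (suc (suc e))) (there e∈) =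
  ∈-route⁻ d e (∈-shift⁻ {F} e∈)
∈-route⁻ {suc F} (true  ∷ d) (suc (suc (suc e))) (there (there e∈)) =
  ∈-route⁻ d e (∈-shift⁻ {F} e∈)

δ : Bool → Bool → ℕ
δ κ κ′ = if does (κ Bool.≟ κ′) then 1 else 0

pathFlow-route : ∀ {F} (d : Vec Bool F) walk e →
  pathFlow (chain F) (mkPath (route d) walk) e ≡ δ (detour? {F} e) (lookup d (stage e))
pathFlow-route {F} d walk e with detour? {F} e Bool.≟ lookup d (stage e)
... | yes p = cong (if_then 1 else 0) (dec-true (DecMembership._∈?_ Fin._≟_ e (route d)) (∈-route⁺ d e p))
... | no ¬p = cong (if_then 1 else 0) (dec-false (DecMembership._∈?_ Fin._≟_ e (route d)) (¬p ∘ ∈-route⁻ d e))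

-- The two routes differ at stage `j` only. Hence the preference of either heuristic can be tested
-- one stage at a time.
length-detour : ∀ {F} (d : Vec Bool F) j →
  length (route (d [ j ]≔ true)) ≡ suc (length (route (d [ j ]≔ false)))
length-detour {suc F} (_     ∷ d) zero    = refl
length-detour {suc F} (false ∷ d) (suc j)
  rewrite length-map (3 ↑ʳ_) (route (d [ j ]≔ true))
        | length-map (3 ↑ʳ_) (route (d [ j ]≔ false)) = cong suc (length-detour d j)
length-detour {suc F} (true  ∷ d) (suc j)
  rewrite length-map (3 ↑ʳ_) (route (d [ j ]≔ true))
        | length-map (3 ↑ʳ_) (route (d [ j ]≔ false)) = cong (2 +_) (length-detour d j)

-- Flows on the chain

preferred : Heuristic → Bool
preferred greedy-longest  = true
preferred greedy-shortest = false

-- For both heuristics this unfolds to the same fact: the route with the detour at `j` is strictly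
-- longer.
preferred-better : ∀ h {F} (d : Vec Bool F) j →
  ¬ AtLeastAsGood h (length (route (d [ j ]≔ not (preferred h))))
                    (length (route (d [ j ]≔ preferred h)))
preferred-better greedy-longest  d j = ℕ.<⇒≱ (ℕ.≤-reflexive (sym (length-detour d j)))
preferred-better greedy-shortest d j = ℕ.<⇒≱ (ℕ.≤-reflexive (sym (length-detour d j)))

-- The flow, out of a total of T, on the option κ of a stage whose option π
-- carries n.
share : Bool → ℕ → Bool → ℕ → ℕ
share π T κ n = if does (κ Bool.≟ π) then n else T ∸ n

flow : ∀ {F} → Bool → ℕ → Vec ℕ F → Fin (F * 3) → ℕ
flow {F} π T a e = share π T (detour? {F} e) (lookup a (stage e))

share-total : ∀ π {T n} → n ≤ T → share π T false n + share π T true n ≡ T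
share-total true  n≤T = ℕ.m∸n+n≡m n≤T
share-total false n≤T = ℕ.m+[n∸m]≡n n≤T

-- Keeps `T ∸ n` in `share` from truncating, so that the two options of a stage add up to `T`.
Bounded : ∀ {F} → ℕ → Vec ℕ F → Set
Bounded T a = ∀ j → lookup a j ≤ T

module _ (π : Bool) (T : ℕ) where

  inflow-first : ∀ {F} (a : Vec ℕ F) → inflow (chain F) (flow π T a) zero ≡ 0
  inflow-first         []      = refl
  inflow-first {suc F} (_ ∷ a) = sum-replicate-zero (F * 3)

  outflow-first : ∀ {F} (a : Vec ℕ (suc F)) → Bounded T a →
                  outflow (chain (suc F)) (flow π T a) zero ≡ T
  outflow-first {F} (n ∷ a) a≤T
    rewrite sum-replicate-zero (F * 3) | ℕ.+-identityʳ (share π T true n)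
    = share-total π (a≤T zero)

  flow-isFlow : ∀ {F} (a : Vec ℕ F) → Bounded T a → IsFlow (chain F) (flow π T a)
  flow-isFlow [] _ zero v≢s _ = contradiction refl v≢s
  flow-isFlow {suc F} (n ∷ a) _ zero v≢s _ = contradiction refl v≢s
  -- The middle of a detour: one edge enters, one leaves, and both carry the share of `true`.
  flow-isFlow {suc F} (n ∷ a) _ (suc zero) _ _ = refl
  flow-isFlow {suc zero} (n ∷ []) _ (suc (suc zero)) _ v≢t = contradiction refl v≢t
  -- The joint of two stages: each of them carries `T` in total.
  flow-isFlow {suc (suc F)} (n ∷ a) a≤T (suc (suc zero)) _ _ = begin
    share π T false n + (share π T true n + inflow (chain (suc F)) (flow π T a) zero)
      ≡⟨ cong (λ z → share π T false n + (share π T true n + z)) (inflow-first a) ⟩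
    share π T false n + (share π T true n + 0)
      ≡⟨ cong (share π T false n +_) (ℕ.+-identityʳ _) ⟩
    share π T false n + share π T true n
      ≡⟨ share-total π (a≤T zero) ⟩
    T
      ≡⟨ outflow-first a (a≤T ∘ suc) ⟨
    outflow (chain (suc F)) (flow π T a) zero ∎
    where open ≡-Reasoning
  flow-isFlow {suc F} (n ∷ a) a≤T (suc (suc v@(suc _))) _ v≢t =
    flow-isFlow a (a≤T ∘ suc) v (λ ()) (v≢t ∘ cong (2 ↑ʳ_))

-- Lower bound on greedy

-- The invariant of a greedy run. It restricts no further entries, so stages whose preferred option
-- is already empty may stay in `a`.
Covers : ∀ {F} → ℕ → Vec ℕ F → Set
Covers T a = ∀ {x} → x < T → ∃[ j ] lookup a j ≡ suc x

covers-pred : ∀ {F T} {a : Vec ℕ F} → Covers (suc T) a → Covers T (Vec.map pred a)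
covers-pred {a = a} cov x<T with j , p ← cov (s≤s x<T) =
  j , trans (lookup-map j pred a) (cong pred p)

share-preferred : ∀ π T n → share π T π n ≡ n
share-preferred true  T n = refl
share-preferred false T n = refl

flow-preferred : ∀ {F} π T (a : Vec ℕ F) j → ∃[ e ]
  stage e ≡ j × detour? {F} e ≡ π × flow π T a e ≡ lookup a j
flow-preferred π T a j with e , refl , refl ← edgeOf j π =
  e , refl , refl , share-preferred π T _

-- The hypotheses say that the path takes the preferred option exactly when it carries flow. If it
-- does, that option loses 1 and the other keeps `suc T ∸ n`, which is `T ∸ pred n`. If not, the
-- other option drops from `suc T` to `T` and the preferred one stays at 0.
share-step : ∀ T κ κ′ π n → (κ′ ≡ π → n ≢ 0) → (n ≢ 0 → κ′ ≡ π) →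
  share π (suc T) κ n ∸ 1 * δ κ κ′ ≡ share π T κ (pred n)
share-step T κ     κ′    π     (suc n) _  to with refl ← to (λ ()) with κ Bool.≟ κ′
... | yes _ = refl
... | no  _ = refl
share-step T true  true  true  zero    fr _ = contradiction refl (fr refl)
share-step T false true  true  zero    fr _ = contradiction refl (fr refl)
share-step T true  false false zero    fr _ = contradiction refl (fr refl)
share-step T false false false zero    fr _ = contradiction refl (fr refl)
share-step T true  true  false zero    _  _ = refl
share-step T true  false true  zero    _  _ = refl
share-step T false true  false zero    _  _ = refl
share-step T false false true  zero    _  _ = refl

module _ {F : ℕ} (h : Heuristic) where

  private
    π : Bool
    π = preferred h

  available-positive : ∀ T a {X} (d : Vec Bool F) walk → (∀ e → X e ≡ flow π T a e) →
    Available (chain F) X (mkPath (route d) walk) →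
    ∀ j → lookup d j ≡ π → lookup a j ≢ 0
  available-positive T a d walk X≗ avail j dj≡π aj≡0
    with e , refl , κ≡π , p ← flow-preferred π T a j
    = ℕ.<⇒≢ (avail (∈-route⁺ d e (trans κ≡π (sym dj≡π))))
            (sym (trans (X≗ e) (trans p aj≡0)))

  -- Exchange argument: if the path avoided a preferred option that carries flow, switching at that
  -- stage alone would give an available path that the heuristic ranks strictly higher.
  greedy-preferred : ∀ T a {X} (d : Vec Bool F) walk → (∀ e → X e ≡ flow π T a e) →
    GreedyChoice (chain F) h X (mkPath (route d) walk) →
    ∀ j → lookup a j ≢ 0 → lookup d j ≡ π
  greedy-preferred T a {X} d walk X≗ (avail , best) j aj≢0
    with lookup d j Bool.≟ π
  ... | yes dj≡π = dj≡π
  ... | no  dj≢π = contradiction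
      (subst (λ d′ → AtLeastAsGood h (length (route d′)) (length (route (d [ j ]≔ π))))
             (sym d≡) (best (routePath (d [ j ]≔ π)) avail′))
      (preferred-better h d j)
    where
    d≡ : d [ j ]≔ not π ≡ d
    d≡ = trans (cong (d [ j ]≔_) (sym (Bool.¬-not dj≢π))) ([]≔-lookup d j)

    avail′ : Available (chain F) X (routePath (d [ j ]≔ π))
    avail′ {e} e∈ with stage e Fin.≟ j | ∈-route⁻ (d [ j ]≔ π) e e∈
    -- At stage `j` the new path uses the preferred option, which carries `lookup a j`; elsewhere
    -- its edges lie on the old path.
    ... | yes refl | κ≡ = subst (0 <_) (sym Xe≡) (ℕ.n≢0⇒n>0 aj≢0)
      where
      Xe≡ : X e ≡ lookup a (stage e)
      Xe≡ = trans (X≗ e) (trans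
        (cong (λ κ → share π T κ (lookup a (stage e))) (trans κ≡ (lookup∘update j d π)))
        (share-preferred π T _))
    ... | no  e≢j  | κ≡ = avail (∈-route⁺ d e (trans κ≡ (lookup∘update′ e≢j d π)))

  -- Each step lowers `T` by one and turns `a` into its predecessors. Agreement of `X` with `flow`
  -- is only pointwise because the remaining flow is given by a different expression.
  greedy-slow : ∀ T (a : Vec ℕ F) {X g} → Covers T a → (∀ e → X e ≡ flow π T a e) →
                GreedyRun (chain F) h X g → T ≤ g
  greedy-slow zero    a cov X≗ run = z≤n
  greedy-slow (suc T) a cov X≗ (done X≡0)
    with j , aj≡1 ← cov (s≤s z≤n)
    with e , _ , _ , p ← flow-preferred π (suc T) a j
    with () ← trans (sym (X≡0 e)) (trans (X≗ e) (trans p aj≡1))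
  greedy-slow (suc T) a {X} cov X≗ (step (mkPath es walk) w choice ((e₀ , e₀∈ , Xe₀≡w) , min) run)
    with d , refl ← walk-route F walk
    = s≤s (greedy-slow T (Vec.map pred a) (covers-pred {a = a} cov) X′≗ run)
    where
    w≤1 : w ≤ 1
    -- The stage of value 1 is the bottleneck: its preferred option carries flow, so the path runs
    -- through it.
    w≤1 with j , aj≡1 ← cov (s≤s z≤n)
        with e , refl , κ≡π , p ← flow-preferred π (suc T) a j
        = subst (w ≤_) (trans (X≗ e) (trans p aj≡1)) (min (∈-route⁺ d e (trans κ≡π (sym
            (greedy-preferred (suc T) a d walk X≗ choice j (λ q → ℕ.0≢1+n (trans (sym q) aj≡1)))))))

    w≡1 : w ≡ 1
    w≡1 = ℕ.≤-antisym w≤1 (subst (0 <_) Xe₀≡w (proj₁ choice e₀∈))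

    X′≗ : ∀ e → X e ∸ w * pathFlow (chain F) (mkPath (route d) walk) e
              ≡ flow π T (Vec.map pred a) e
    X′≗ e rewrite w≡1 | X≗ e | pathFlow-route d walk e | lookup-map (stage e) pred a =
      share-step T (detour? {F} e) (lookup d (stage e)) π (lookup a (stage e))
        (available-positive (suc T) a d walk X≗ (proj₁ choice) (stage e))
        (greedy-preferred (suc T) a d walk X≗ choice (stage e))

-- Upper bound on the optimum

-- This is 2ᵇ - 1, in a form that exposes the top bit `suc (allOnes b)` by computation.
allOnes : ℕ → ℕ
allOnes zero    = 0
allOnes (suc b) = suc (allOnes b + allOnes b)

bitWeight : ∀ b → Fin b → ℕ
bitWeight (suc b) zero    = suc (allOnes b)
bitWeight (suc b) (suc i) = bitWeight b i

weightOn : ∀ b → (Fin b → Bool) → Bool → ℕ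
weightOn b κs κ = sum λ i → bitWeight b i * δ κ (κs i)

-- Two numbers of sum 2T + 1 cannot both be at most `T`. The larger one takes the weight `suc T`,
-- and what is left sums to `T`.
split-top-bit : ∀ T x y → x + y ≡ suc (T + T) →
  (∃[ x′ ] x ≡ suc T + x′ × x′ + y ≡ T) ⊎ (∃[ y′ ] y ≡ suc T + y′ × x + y′ ≡ T)
split-top-bit T x y p with suc T ℕ.≤? x
... | yes T<x = inj₁ (x ∸ suc T , sym (ℕ.m+[n∸m]≡n T<x) ,
  ℕ.+-cancelˡ-≡ (suc T) _ _ (trans (sym (ℕ.+-assoc (suc T) (x ∸ suc T) y))
    (trans (cong (_+ y) (ℕ.m+[n∸m]≡n T<x)) p)))
... | no  T≮x = inj₂ (T ∸ x , y≡ , ℕ.m+[n∸m]≡n x≤T)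
  where
  x≤T = ℕ.≮⇒≥ T≮x
  y≡ : y ≡ suc T + (T ∸ x)
  y≡ = ℕ.+-cancelˡ-≡ x _ _ (trans p (sym (trans (ℕ.+-comm x _)
    (trans (ℕ.+-assoc (suc T) (T ∸ x) x) (cong (suc T +_) (ℕ.m∸n+n≡m x≤T))))))

-- Numbers that add up to 2ᵇ - 1 have complementary binary digits, so each weight goes to exactly
-- one option; `κs i` is the option that receives the weight of `i`.
split-weights : ∀ b (p : Bool → ℕ) → p false + p true ≡ allOnes b →
                ∃[ κs ] (∀ κ → p κ ≡ weightOn b κs κ)
split-weights zero p total = (λ ()) , λ where
  false → ℕ.m+n≡0⇒m≡0 (p false) total
  true  → ℕ.m+n≡0⇒n≡0 (p false) total
split-weights (suc b) p total with split-top-bit (allOnes b) (p false) (p true) total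
... | inj₁ (x′ , x≡ , total′)
  with κs , q ← split-weights b (λ κ → if κ then p true else x′) total′
  = (λ { zero → false ; (suc i) → κs i }) , λ where
    false → trans x≡ (cong₂ _+_ (sym (ℕ.*-identityʳ _)) (q false))
    true  → trans (q true) (cong (_+ weightOn b κs true) (sym (ℕ.*-zeroʳ (allOnes b))))
... | inj₂ (y′ , y≡ , total′)
  with κs , q ← split-weights b (λ κ → if κ then y′ else p false) total′
  = (λ { zero → true ; (suc i) → κs i }) , λ where
    false → trans (q false) (cong (_+ weightOn b κs false) (sym (ℕ.*-zeroʳ (allOnes b))))
    true  → trans y≡ (cong₂ _+_ (sym (ℕ.*-identityʳ _)) (q true))

-- Any choice of one option per stage is a path, so the stages can be split independently; path `i`
-- follows the options that receive weight `i`.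
binary-decomposition : ∀ {F} π b (a : Vec ℕ F) → Bounded (allOnes b) a →
                       Decomposition (chain F) (flow π (allOnes b) a) b
binary-decomposition {F} π b a a≤T = record
  { path    = λ i → routePath (routes i)
  ; weight  = bitWeight b
  ; correct = λ e → trans (proj₂ (split (stage e)) (detour? {F} e)) (sum-cong-≗ λ i →
      cong (bitWeight b i *_) (sym (trans
        (pathFlow-route (routes i) (route-walk (routes i)) e)
        (cong (δ (detour? {F} e)) (lookup∘tabulate (λ j → proj₁ (split j) i) (stage e))))))
  }
  where
  split : ∀ j → ∃[ κs ] (∀ κ → share π (allOnes b) κ (lookup a j) ≡ weightOn b κs κ)
  split j = split-weights b _ (share-total π (a≤T j))

  routes : Fin b → Vec Bool F
  routes i = tabulate λ j → proj₁ (split j) i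

-- The family of instances and its constants

countdown : ∀ F → Vec ℕ F
countdown zero    = []
countdown (suc F) = suc F ∷ countdown F

countdown-bounded : ∀ F → Bounded F (countdown F)
countdown-bounded (suc F) zero    = ℕ.≤-refl
countdown-bounded (suc F) (suc j) = ℕ.m≤n⇒m≤1+n (countdown-bounded F j)

countdown-covers : ∀ F → Covers F (countdown F)
countdown-covers (suc F) {x} (s≤s x≤F) with x ℕ.≟ F
... | yes refl = zero , refl
... | no  x≢F with j , p ← countdown-covers F (ℕ.≤∧≢⇒< x≤F x≢F) = suc j , p

hard : Heuristic → ℕ → Instance
hard h b = record
  { G       = chain F
  ; X       = flow π F (countdown F)
  ; isFlow  = flow-isFlow π F (countdown F) (countdown-bounded F)
  ; nonZero = let e , _ , _ , p = flow-preferred π F (countdown F) zero in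
              e , λ Xe≡0 → ℕ.0≢1+n (trans (sym Xe≡0) p)
  }
  where
  -- The successor makes `F` positive, so there is a first stage, and its preferred option carries
  -- `F`.
  F = allOnes (suc b)
  π = preferred h

2^b≡1+allOnes : ∀ b → 2 ^ b ≡ suc (allOnes b)
2^b≡1+allOnes zero    = refl
2^b≡1+allOnes (suc b) rewrite 2^b≡1+allOnes b | ℕ.+-identityʳ (allOnes b) =
  cong suc (ℕ.+-suc (allOnes b) (allOnes b))

n≤allOnes : ∀ n → n ≤ allOnes n
n≤allOnes zero    = z≤n
n≤allOnes (suc n) = s≤s (ℕ.m≤n⇒m≤n+o (allOnes n) (n≤allOnes n))

-- The number of edges is 3F with F + 1 = 2ᵇ⁺¹, and F + 1 ≤ 3F, so its logarithm is at least the
-- number of paths in the binary decomposition.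
b≤log₂ : ∀ b → suc b ≤ ⌊log₂ allOnes (suc b) * 3 ⌋
b≤log₂ b = begin
  suc b                          ≡⟨ ⌊log₂[2^n]⌋≡n (suc b) ⟨
  ⌊log₂ 2 ^ suc b ⌋              ≡⟨ cong ⌊log₂_⌋ (2^b≡1+allOnes (suc b)) ⟩
  ⌊log₂ suc (allOnes (suc b)) ⌋  ≤⟨ ⌊log₂⌋-mono-≤ (1+n≤n*3 (allOnes b + allOnes b)) ⟩
  ⌊log₂ allOnes (suc b) * 3 ⌋    ∎
  where
  open ℕ.≤-Reasoning
  1+n≤n*3 : ∀ n → suc (suc n) ≤ suc n * 3
  1+n≤n*3 n = s≤s (s≤s (ℕ.m≤n⇒m≤1+n (ℕ.m≤m*n n 3)))

sparse : ∀ F → fromℕ (F * 3) ≤ᵘ fromℕ 2 *ᵘ fromℕ (suc (F * 2))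
sparse F = *≤* (subst₂ ℤ._≤_ (sym (ℤ.*-identityʳ (ℤ.+ (F * 3)))) (sym (ℤ.*-identityʳ _))
  (ℤ.+≤+ le))
  where
  open ℕ.≤-Reasoning
  le : F * 3 ≤ 2 * suc (F * 2)
  le = begin
    F * 3             ≤⟨ ℕ.*-monoʳ-≤ F (ℕ.n≤1+n 3) ⟩
    F * 4             ≡⟨ ℕ.*-assoc F 2 2 ⟨
    F * 2 * 2         ≡⟨ ℕ.*-comm (F * 2) 2 ⟩
    2 * (F * 2)       ≤⟨ ℕ.*-monoʳ-≤ 2 (ℕ.n≤1+n (F * 2)) ⟩
    2 * suc (F * 2)   ∎

ratio : ∀ F k g ℓ → F ≤ g → k ≤ ℓ →
  (ℤ.+ 1 / 3) *ᵘ fromℕ (F * 3) *ᵘ fromℕ k ≤ᵘ fromℕ g *ᵘ fromℕ ℓ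
ratio F k g ℓ F≤g k≤ℓ = *≤* (begin
  (ℤ.+ 1 ℤ.* ℤ.+ (F * 3)) ℤ.* ℤ.+ k ℤ.* ℤ.+ 1
    ≡⟨ ℤ.*-identityʳ _ ⟩
  (ℤ.+ 1 ℤ.* ℤ.+ (F * 3)) ℤ.* ℤ.+ k
    ≡⟨ cong (ℤ._* ℤ.+ k) (ℤ.*-identityˡ (ℤ.+ (F * 3))) ⟩
  ℤ.+ (F * 3) ℤ.* ℤ.+ k
    ≡⟨ ℤ.pos-* (F * 3) k ⟨
  ℤ.+ (F * 3 * k)
    ≤⟨ ℤ.+≤+ le ⟩
  -- The factor 3 is the denominator of the constant 1/3, which cancels the three edges per stage.
  ℤ.+ (g * ℓ * 3)
    ≡⟨ ℤ.pos-* (g * ℓ) 3 ⟩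
  ℤ.+ (g * ℓ) ℤ.* ℤ.+ 3
    ≡⟨ cong (ℤ._* ℤ.+ 3) (ℤ.pos-* g ℓ) ⟩
  ℤ.+ g ℤ.* ℤ.+ ℓ ℤ.* ℤ.+ 3 ∎)
  where
  open ℤ.≤-Reasoning
  le : F * 3 * k ≤ g * ℓ * 3
  le = ℕ.≤-trans (ℕ.≤-reflexive (trans (ℕ.*-assoc F 3 k)
         (trans (cong (F *_) (ℕ.*-comm 3 k)) (sym (ℕ.*-assoc F k 3)))))
       (ℕ.*-monoˡ-≤ 3 (ℕ.*-mono-≤ F≤g k≤ℓ))

mainTheorem2 : (h : Heuristic) →
    Σ[ c ∈ ℚᵘ ] Σ[ C ∈ ℚᵘ ] 0ℚᵘ <ᵘ c × 0ℚᵘ <ᵘ C ×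
    (Σ[ I ∈ (ℕ → Instance) ]
    (∀ N → ∃[ i ] N ≤ ∣E∣ (I i)) ×
    (∀ i →
    fromℕ (∣E∣ (I i)) ≤ᵘ C *ᵘ fromℕ (∣V∣ (I i)) ×
    (∀ k g → IsMFD (G (I i)) (X (I i)) k → GreedyRun (G (I i)) h (X (I i)) g →
    c *ᵘ fromℕ (∣E∣ (I i)) *ᵘ fromℕ k ≤ᵘ fromℕ g *ᵘ fromℕ ⌊log₂ ∣E∣ (I i) ⌋)))
mainTheorem2 h = ℤ.+ 1 / 3 , fromℕ 2 , *<* (ℤ.+<+ (s≤s z≤n)) , *<* (ℤ.+<+ (s≤s z≤n)) ,
  hard h ,
  (λ N → N , ℕ.≤-trans (ℕ.n≤1+n N) (ℕ.≤-trans (n≤allOnes (suc N)) (ℕ.m≤m*n _ 3))) ,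
  λ b → let F = allOnes (suc b) in
    sparse F ,
    λ k g (_ , minimal) run → ratio F k g ⌊log₂ F * 3 ⌋
      (greedy-slow h F (countdown F) (countdown-covers F) (λ _ → refl) run)
      -- The optimum is at most the size `suc b` of the binary decomposition, hence at most the
      -- logarithm.
      (ℕ.≤-trans (minimal (suc b) (binary-decomposition (preferred h) (suc b) (countdown F) (countdown-bounded F)))
                 (b≤log₂ b))
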